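{- Let $A$ be a finite set. The alternating conservative revital $ECons(A)$ is finitely generated, i.e. there is a finite set $P\subseteq B(A)$ with $\lceil P\rceil=ECons(A)$. Moreover, a gate set $P\subseteq ECons(A)$ generates the whole of $ECons(A)$ (that is, $\lceil P\rceil = ECons(A)$) if $\lceil P\rceil$ contains, for all $n\leq 6$, all conservative permutations of $A^n$ that are even on every weight class of $A^n$.
   Context: For a finite set $A$ and a positive integer $n$, $B_n(A)=\mathrm{Sym}(A^n)$ is the group of bijections $A^n\to A^n$ and $B(A)=\bigcup_n B_n(A)$; its elements are called gates. For $\alpha\in S_n$, the wire permutation is $\pi_\alpha(x_1,\dots,x_n)=(x_{\alpha^{ -1}(1)},\dots,x_{\alpha^{ -1}(n)})$; a rewiring of $f\in B_n(A)$ is $\pi_\alpha\circ f\circ\pi_\alpha^{ -1}$ for some $\alpha\in S_n$. For $f\in B_n(A)$, $g\in B_m(A)$, $f\oplus g\in B_{n+m}(A)$ applies $f$ to the first $n$ coordinates and $g$ to the last $m$; $\mathrm{id}_k$ is the identity of $A^k$. The extensions of $f\in B_\ell(A)$ on $A^n$, $n\ge\ell$, are the rewirings of $f\oplus \mathrm{id}_{n-\ell}$. For $P\subseteq B(A)$, $\lceil P\rceil\subseteq B(A)$ is the set of all gates obtained from $\mathrm{id}_1$ and the elements of $P$ by compositions of gates of equal arity and extensions. A set $C\subseteq B(A)$ with $C=\lceil C\rceil$ is called a revital. The weight of a word $x\in A^n$ is the function $w_n(x)\in\mathbb N^A$ where $w_n(x)(a)$ is the number of occurrences of $a$ in $x$;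 a weight class of $A^n$ is the set of all words in $A^n$ with a given weight (attained by some word). A gate $f\in B_n(A)$ is conservative if $w_n(f(x))=w_n(x)$ for all $x\in A^n$; such an $f$ permutes each weight class. $ECons(A)$ is the set of all conservative gates (of all arities) whose restriction to each weight class is an even permutation. -}

module Defs where

open import Data.Fin.Permutation using (Permutation′; _⟨$⟩ˡ_; _⟨$⟩ʳ_; inverseˡ; inverseʳ)
open import Data.Fin.Base using (Fin)
open import Data.Fin.Properties using (inj⇒≟)
import Data.Irrelevant as Irrelevant
open import Data.List.Base using (List; foldr; length)
open import Data.List.Relation.Unary.All using (All)
open import Data.Nat.Base using (ℕ; suc; _+_)
open import Data.Nat.Divisibility using (_∣_)
open import Data.Product.Base using (Σ-syntax; ∃-syntax; _×_; _,_; uncurry)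
open import Data.Product.Function.NonDependent.Propositional using (_×-↔_)
open import Data.Refinement using (Refinement-syntax; _,_; value-injective)
import Data.Refinement.Properties as Refinement
open import Data.Vec.Base using (Vec; _++_; take; drop; lookup; tabulate; count)
open import Data.Vec.Properties
  using (take++drop≡id; ++-injective; lookup∘tabulate; tabulate∘lookup; tabulate-cong; ≡-dec)
open import Function.Bundles using (_↔_; Inverse; mk↔ₛ′)
open import Function.Construct.Composition using (_↔-∘_)
open import Function.Construct.Identity using (↔-id)
open import Function.Construct.Symmetry using (↔-sym)
open import Function.Properties.Inverse using (↔⇒↣)
open import Level using (Level; _⊔_)
open import Relation.Binary.Definitions using (DecidableEquality)
open import Relation.Binary.PropositionalEquality
  using (_≡_; _≢_; _≗_; sym; trans; cong; cong₂)
open import Relation.Nullary.Decidable.Core using (yes; no)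
open import Relation.Unary using (Pred)

open Inverse using (to; from; strictlyInverseˡ; strictlyInverseʳ)

B : ∀ {a} → Set a → ℕ → Set a
B A n = Vec A n ↔ Vec A n

-- Arities are positive: the pair (m , f) is a gate f of arity suc m.
Gate : ∀ {a} → Set a → Set a
Gate A = Σ[ m ∈ ℕ ] B A (suc m)

module _ {a} {A : Set a} where

  infix 4 _≈_
  infixr 6 _⊕_

  _≈_ : ∀ {n} → B A n → B A n → Set a
  f ≈ g = to f ≗ to g

  ++-↔ : ∀ m {n} → (Vec A m × Vec A n) ↔ Vec A (m + n)
  ++-↔ m = mk↔ₛ′ (uncurry _++_) (λ x → take m x , drop m x) (take++drop≡id m) split-++
    where
    split-++ : ∀ p → (take m (uncurry _++_ p) , drop m (uncurry _++_ p)) ≡ p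
    split-++ (u , v) = uncurry (cong₂ _,_) (++-injective _ u (take++drop≡id m (u ++ v)))

  _⊕_ : ∀ {m n} → B A m → B A n → B A (m + n)
  _⊕_ {m} f g = ++-↔ m ↔-∘ ((f ×-↔ g) ↔-∘ ↔-sym (++-↔ m))

  wire : ∀ {n} → Permutation′ n → B A n
  wire α = mk↔ₛ′
    (λ x → tabulate λ i → lookup x (α ⟨$⟩ˡ i))
    (λ x → tabulate λ i → lookup x (α ⟨$⟩ʳ i))
    (λ x → trans
      (tabulate-cong λ i → trans (lookup∘tabulate _ (α ⟨$⟩ˡ i)) (cong (lookup x) (inverseʳ α)))
      (tabulate∘lookup x))
    (λ x → trans
      (tabulate-cong λ i → trans (lookup∘tabulate _ (α ⟨$⟩ʳ i)) (cong (lookup x) (inverseˡ α)))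
      (tabulate∘lookup x))

  rewire : ∀ {n} → Permutation′ n → B A n → B A n
  rewire α f = wire α ↔-∘ (f ↔-∘ ↔-sym (wire α))

-- An inverse bundle carries more than its underlying function, and without
-- function extensionality pointwise equal gates need not be propositionally
-- equal; respect identifies them.
data ⌈_⌉ {a ℓ} {A : Set a} (P : Pred (Gate A) ℓ) : Pred (Gate A) (a ⊔ ℓ) where
  identity  : ⌈ P ⌉ (0 , ↔-id _)
  generator : ∀ {g} → P g → ⌈ P ⌉ g
  compose   : ∀ {m} {f g : B A (suc m)} → ⌈ P ⌉ (m , f) → ⌈ P ⌉ (m , g) → ⌈ P ⌉ (m , f ↔-∘ g)
  extend    : ∀ {m} {f : B A (suc m)} k (α : Permutation′ (suc m + k)) →
              ⌈ P ⌉ (m , f) → ⌈ P ⌉ (m + k , rewire α (f ⊕ ↔-id (Vec A k)))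
  respect   : ∀ {m} {f g : B A (suc m)} → f ≈ g → ⌈ P ⌉ (m , f) → ⌈ P ⌉ (m , g)

module _ {x} {X : Set x} (_≟_ : DecidableEquality X) where

  transposition : X → X → X → X
  transposition i j k with k ≟ i | k ≟ j
  ... | yes _ | _     = j
  ... | no  _ | yes _ = i
  ... | no  _ | no  _ = k

  Even : X ↔ X → Set x
  Even σ = ∃[ ts ] All (uncurry _≢_) ts × 2 ∣ length ts
                 × to σ ≗ λ z → foldr (uncurry transposition) z ts

module _ {a k} {A : Set a} (finite : A ↔ Fin k) where

  _≟_ : DecidableEquality A
  _≟_ = inj⇒≟ (↔⇒↣ finite)

  weight : ∀ {n} → Vec A n → A → ℕ
  weight x b = count (_≟ b) x

  -- Every attained weight is the weight of some word u, so weight classes are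
  -- indexed by representatives. Membership proofs are irrelevant, so equality
  -- in a class is equality of words.
  WeightClass : ∀ {n} → Vec A n → Set a
  WeightClass {n} u = [ x ∈ Vec A n ∣ weight x ≗ weight u ]

  class-≟ : ∀ {n} (u : Vec A n) → DecidableEquality (WeightClass u)
  class-≟ u = Refinement._≟_ (≡-dec _≟_)

  Conservative : ∀ {n} → B A n → Set a
  Conservative f = ∀ x → weight (to f x) ≗ weight x

  restrict : ∀ {n} (f : B A n) → Conservative f → ∀ u → WeightClass u ↔ WeightClass u
  restrict f c u = mk↔ₛ′
    (λ (x , p) → to f x , Irrelevant.map (λ q a → trans (c x a) (q a)) p)
    (λ (x , p) → from f x , Irrelevant.map (λ q a → trans (from-c x a) (q a)) p)
    (λ (x , _) → value-injective (strictlyInverseˡ f x))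
    (λ (x , _) → value-injective (strictlyInverseʳ f x))
    where
    from-c : ∀ x → weight (from f x) ≗ weight x
    from-c x a = trans (sym (c (from f x) a)) (cong (λ y → weight y a) (strictlyInverseˡ f x))

  ECons : Pred (Gate A) a
  ECons (_ , f) = Σ[ c ∈ Conservative f ] ∀ u → Even (class-≟ u) (restrict f c u)

{-# OPTIONS --safe #-}

-- By induction on the arity n ≥ 7. An even conservative gate is a product of
-- pairs of transpositions of words of one weight class. A weight class is
-- connected under swapping two letters, so it suffices to generate the 3-cycles
-- (s t u) where t and u are each one swap away from s. Such a 3-cycle is the
-- commutator of two 3-cycles of arity n − 1, each extended by a wire it does not
-- touch, provided the supports of the two extensions meet only in s; seven wires
-- leave enough room to choose them so. Conversely, an extension of an even gate is
-- even on a weight class because it acts separately for each value of the added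
-- wires. In particular the pairs of transpositions of arity at most 6 generate.
module Submission where

open import Data.Bool.Base using (if_then_else_; true; false)
open import Data.Fin.Base using (Fin; zero; suc; _↑ʳ_)
import Data.Fin.Permutation as Perm
open import Data.Fin.Permutation using (Permutation′; _⟨$⟩ˡ_; _⟨$⟩ʳ_; inverseʳ)
import Data.Fin.Permutation.Components as PC
import Data.Fin.Properties as Fin
open import Data.Irrelevant using ([_])
open import Data.List.Base
  using (List; []; _∷_; foldr; length; map; filter; concatMap; upTo; allFin; cartesianProductWith; cartesianProduct)
import Data.List.Base as List
open import Data.List.Membership.DecPropositional using (_∈?_)
open import Data.List.Membership.Propositional using (_∈_; _∉_; find; lose)
import Data.List.Membership.Propositional.Properties as ∈
import Data.List.Membership.Setoid.Properties as ∈ₛ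
open import Data.List.Properties using (foldr-++; length-++; length-map)
open import Data.List.Relation.Unary.All as All using (All; []; _∷_)
import Data.List.Relation.Unary.All.Properties as All
open import Data.List.Relation.Unary.Any as Any using (Any; here; there; any?)
open import Data.Nat.Base using (ℕ; suc; _+_; _≤_; _<_; z≤n; s≤s; s≤s⁻¹)
open import Data.Nat.Divisibility using (_∣_; _∣0; _∣?_; ∣m∣n⇒∣m+n; ∣m+n∣m⇒∣n; ∣-refl)
import Data.Nat.Properties as ℕ
open import Data.Product.Base using (Σ-syntax; ∃-syntax; _×_; _,_; uncurry; proj₁; proj₂)
open import Data.Refinement using (value; value-injective; _,_)
open import Data.Sum.Base using (_⊎_; inj₁; inj₂)
open import Data.Vec.Base using (Vec; []; _∷_; _++_; count; lookup; _[_]≔_)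
import Data.Vec.Properties as Vec
open import Function.Base using (_∘_; id)
open import Function.Bundles using (_↔_; Inverse; mk↔ₛ′)
open import Function.Construct.Composition using (_↔-∘_)
open import Function.Construct.Identity using (↔-id)
open import Function.Construct.Symmetry using (↔-sym)
open import Function.Definitions using (Injective)
open import Level using (_⊔_)
open import Relation.Binary.Construct.Closure.ReflexiveTransitive using (Star; ε; _◅_; _◅◅_; gmap)
open import Relation.Binary.Core using (Rel)
open import Relation.Binary.Definitions using (DecidableEquality; Reflexive; Symmetric; Transitive)
import Relation.Binary.Definitions as Binary
open import Relation.Binary.PropositionalEquality
  using (_≡_; _≢_; _≗_; refl; sym; trans; cong; cong₂; subst; ≢-sym; setoid)
open import Relation.Nullary.Decidable.Core using (Dec; yes; no; does; map′; recompute; from-no; _×-dec_; ¬?)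
open import Relation.Nullary.Negation.Core using (¬_; contradiction)
open import Relation.Unary using (Pred; Decidable; _⊆_; _≐_)
open import Defs hiding (_≟_)
import Defs

open import Algebra.Properties.CommutativeMonoid.Sum ℕ.+-0-commutativeMonoid using (sum; sum-permute; sum-cong-≗)
open Inverse using (to; from; strictlyInverseˡ; strictlyInverseʳ)

-- Transpositions, even maps and commutators

module Transpositions {x} {X : Set x} (_≟_ : DecidableEquality X) where

  τ : X → X → X → X
  τ = transposition _≟_

  τ-first : ∀ i j → τ i j i ≡ j
  τ-first i j with i ≟ i | i ≟ j
  ... | yes _  | _ = refl
  ... | no i≢i | _ = contradiction refl i≢i

  τ-second : ∀ i j → τ i j j ≡ i
  τ-second i j with j ≟ i | j ≟ j
  ... | yes j≡i | _      = j≡i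
  ... | no _    | yes _  = refl
  ... | no _    | no j≢j = contradiction refl j≢j

  τ-other : ∀ {i j k} → k ≢ i → k ≢ j → τ i j k ≡ k
  τ-other {i} {j} {k} k≢i k≢j with k ≟ i | k ≟ j
  ... | yes k≡i | _       = contradiction k≡i k≢i
  ... | no _    | yes k≡j = contradiction k≡j k≢j
  ... | no _    | no _    = refl

  -- Case analysis without abstracting over the decision procedure.
  data View (i j k : X) : Set x where
    first  : k ≡ i → View i j k
    second : k ≡ j → View i j k
    other  : k ≢ i → k ≢ j → View i j k

  view : ∀ i j k → View i j k
  view i j k with k ≟ i | k ≟ j
  ... | yes k≡i | _       = first k≡i
  ... | no _    | yes k≡j = second k≡j
  ... | no k≢i  | no k≢j  = other k≢i k≢j

  τ-comm : ∀ i j → τ i j ≗ τ j i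
  τ-comm i j k with view i j k
  ... | first refl      = trans (τ-first i j) (sym (τ-second j i))
  ... | second refl     = trans (τ-second i j) (sym (τ-first j i))
  ... | other k≢i k≢j   = trans (τ-other k≢i k≢j) (sym (τ-other k≢j k≢i))

  τ-involutive : ∀ i j k → τ i j (τ i j k) ≡ k
  τ-involutive i j k with view i j k
  ... | first refl    = trans (cong (τ i j) (τ-first i j)) (τ-second i j)
  ... | second refl   = trans (cong (τ i j) (τ-second i j)) (τ-first i j)
  ... | other k≢i k≢j = trans (cong (τ i j) (τ-other k≢i k≢j)) (τ-other k≢i k≢j)

  τ-↔ : X → X → X ↔ X
  τ-↔ i j = mk↔ₛ′ (τ i j) (τ i j) (τ-involutive i j) (τ-involutive i j)

  τ* : List (X × X) → X → X
  τ* ts z = foldr (uncurry τ) z ts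

  τ*-++ : ∀ ss ts → τ* (ss List.++ ts) ≗ τ* ss ∘ τ* ts
  τ*-++ ss ts z = foldr-++ (uncurry τ) z ss ts

  EvenMap : (X → X) → Set x
  EvenMap φ = ∃[ ts ] All (uncurry _≢_) ts × 2 ∣ length ts × φ ≗ τ* ts

  even-resp : ∀ {φ ψ} → φ ≗ ψ → EvenMap φ → EvenMap ψ
  even-resp φ≗ψ (ts , ≢ts , 2∣ts , φ≗ts) = ts , ≢ts , 2∣ts , λ z → trans (sym (φ≗ψ z)) (φ≗ts z)

  even-id : EvenMap id
  even-id = [] , [] , 2 ∣0 , λ _ → refl

  even-∘ : ∀ {φ ψ} → EvenMap φ → EvenMap ψ → EvenMap (φ ∘ ψ)
  even-∘ {φ} (ss , ≢ss , 2∣ss , φ≗ss) (ts , ≢ts , 2∣ts , ψ≗ts) =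
      ss List.++ ts
    , All.++⁺ ≢ss ≢ts
    , subst (2 ∣_) (sym (length-++ ss)) (∣m∣n⇒∣m+n 2∣ss 2∣ts)
    , λ z → trans (cong φ (ψ≗ts z)) (trans (φ≗ss _) (sym (τ*-++ ss ts z)))

module _ {x y} {X : Set x} {Y : Set y} (_≟ˣ_ : DecidableEquality X) (_≟ʸ_ : DecidableEquality Y) where

  private
    module TX = Transpositions _≟ˣ_
    module TY = Transpositions _≟ʸ_

  map² : (X → Y) → List (X × X) → List (Y × Y)
  map² ι = map λ (i , j) → ι i , ι j

  module _ {ι : X → Y} (ι-injective : Injective _≡_ _≡_ ι) where

    τ-natural : ∀ i j k → ι (TX.τ i j k) ≡ TY.τ (ι i) (ι j) (ι k)
    τ-natural i j k with TX.view i j k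
    ... | TX.first refl    = trans (cong ι (TX.τ-first i j)) (sym (TY.τ-first _ _))
    ... | TX.second refl   = trans (cong ι (TX.τ-second i j)) (sym (TY.τ-second _ _))
    ... | TX.other k≢i k≢j =
      trans (cong ι (TX.τ-other k≢i k≢j)) (sym (TY.τ-other (k≢i ∘ ι-injective) (k≢j ∘ ι-injective)))

    τ*-natural : ∀ ts k → ι (TX.τ* ts k) ≡ TY.τ* (map² ι ts) (ι k)
    τ*-natural []             k = refl
    τ*-natural ((i , j) ∷ ts) k =
      trans (τ-natural i j (TX.τ* ts k)) (cong (TY.τ (ι i) (ι j)) (τ*-natural ts k))

    τ*-outside : ∀ ts {y} → (∀ k → y ≢ ι k) → TY.τ* (map² ι ts) y ≡ y
    τ*-outside []             _   = refl
    τ*-outside ((i , j) ∷ ts) y∉ι =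
      trans (cong (TY.τ (ι i) (ι j)) (τ*-outside ts y∉ι)) (TY.τ-other (y∉ι i) (y∉ι j))

    -- An injection carries transpositions to transpositions, so the number of factors and hence the
    -- parity is kept. The images of the factors fix everything outside the range of `ι`, where `ψ`
    -- is the identity as well.
    even-image : ∀ {φ : X → X} {ψ : Y → Y} → TX.EvenMap φ → (∀ k → ψ (ι k) ≡ ι (φ k)) →
      (∀ y → (∃[ k ] y ≡ ι k) ⊎ ((∀ k → y ≢ ι k) × ψ y ≡ y)) → TY.EvenMap ψ
    even-image {φ} {ψ} (ts , ≢ts , 2∣ts , φ≗ts) ψι≡ιφ image =
        map² ι ts
      , All.map⁺ (All.map (_∘ ι-injective) ≢ts)
      , subst (2 ∣_) (sym (length-map _ ts)) 2∣ts
      , ψ≗ts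
      where
      ψ≗ts : ψ ≗ TY.τ* (map² ι ts)
      ψ≗ts y with image y
      ... | inj₁ (k , refl)      = trans (ψι≡ιφ k) (trans (cong ι (φ≗ts k)) (τ*-natural ts k))
      ... | inj₂ (y∉ι , ψy≡y)    = trans ψy≡y (sym (τ*-outside ts y∉ι))

restrictTo : ∀ {x q} {X : Set x} {Q : Pred X q} → Decidable Q → (X → X) → X → X
restrictTo Q? σ x with Q? x
... | yes _ = σ x
... | no _  = x

module _ {x q} {X : Set x} {Q : Pred X q} (Q? : Decidable Q) (σ : X → X) where

  restrictTo-∈ : ∀ {x} → Q x → restrictTo Q? σ x ≡ σ x
  restrictTo-∈ {x} q with Q? x
  ... | yes _ = refl
  ... | no ¬q = contradiction q ¬q

  restrictTo-∉ : ∀ {x} → ¬ Q x → restrictTo Q? σ x ≡ x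
  restrictTo-∉ {x} ¬q with Q? x
  ... | yes q = contradiction q ¬q
  ... | no _  = refl

-- A map that preserves each class of an equivalence relation is the composition of its restrictions
-- to the classes, so a property closed under composition passes from the restrictions to the map.
-- This serves for evenness, with classes given by the added wires, and for generation, with weight
-- classes.
module ClassProduct {x r c} {X : Set x} {_~_ : Rel X r}
  (~-refl : Reflexive _~_) (~-sym : Symmetric _~_) (~-trans : Transitive _~_)
  (_~?_ : Binary.Decidable _~_)
  (C : (X → X) → Set c) (C-resp : ∀ {φ ψ} → φ ≗ ψ → C φ → C ψ)
  (C-id : C id) (C-∘ : ∀ {φ ψ} → C φ → C ψ → C (φ ∘ ψ))
  (σ : X → X) (σ-class : ∀ x → σ x ~ x)
  (C-part : ∀ u → C (restrictTo (_~? u) σ))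
  where

  private
    touches? : ∀ us → Decidable λ x → Any (x ~_) us
    touches? us x = any? (x ~?_) us

  -- Induction on the list of representatives. If the class of `u` is already covered, nothing
  -- changes. Otherwise it is disjoint from the union of the classes covered so far, and the two
  -- restrictions compose without interfering.
  product-of-parts : ∀ us → C (restrictTo (touches? us) σ)
  product-of-parts []       = C-resp (λ _ → refl) C-id
  product-of-parts (u ∷ us) with touches? us u
  ... | yes u∈us = C-resp same (product-of-parts us)
    where
    same : restrictTo (touches? us) σ ≗ restrictTo (touches? (u ∷ us)) σ
    same x = by-cases (touches? us x)
      where
      by-cases : Dec (Any (x ~_) us) → restrictTo (touches? us) σ x ≡ restrictTo (touches? (u ∷ us)) σ x
      by-cases (yes x∈us) = trans
        (restrictTo-∈ (touches? us) σ x∈us)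
        (sym (restrictTo-∈ (touches? (u ∷ us)) σ (there x∈us)))
      by-cases (no x∉us)  = trans
        (restrictTo-∉ (touches? us) σ x∉us)
        (sym (restrictTo-∉ (touches? (u ∷ us)) σ λ
          { (here x~u)   → x∉us (Any.map (~-trans x~u) u∈us)
          ; (there x∈us) → x∉us x∈us }))
  ... | no u∉us = C-resp compose-parts (C-∘ (C-part u) (product-of-parts us))
    where
    compose-parts : restrictTo (_~? u) σ ∘ restrictTo (touches? us) σ ≗ restrictTo (touches? (u ∷ us)) σ
    compose-parts x = by-cases (touches? us x) (x ~? u)
      where
      by-cases : Dec (Any (x ~_) us) → Dec (x ~ u) →
        restrictTo (_~? u) σ (restrictTo (touches? us) σ x) ≡ restrictTo (touches? (u ∷ us)) σ x
      by-cases (yes x∈us) _ = trans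
        (cong (restrictTo (_~? u) σ) (restrictTo-∈ (touches? us) σ x∈us))
        (trans
          -- `σ x` is still in the class of `x`, so if it were in that of `u`, then `u` would be
          -- covered already.
          (restrictTo-∉ (_~? u) σ λ σx~u →
            u∉us (Any.map (~-trans (~-trans (~-sym σx~u) (σ-class x))) x∈us))
          (sym (restrictTo-∈ (touches? (u ∷ us)) σ (there x∈us))))
      by-cases (no x∉us) (yes x~u) = trans
        (cong (restrictTo (_~? u) σ) (restrictTo-∉ (touches? us) σ x∉us))
        (trans
          (restrictTo-∈ (_~? u) σ x~u)
          (sym (restrictTo-∈ (touches? (u ∷ us)) σ (here x~u))))
      by-cases (no x∉us) (no x≁u) = trans
        (cong (restrictTo (_~? u) σ) (restrictTo-∉ (touches? us) σ x∉us))
        (trans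
          (restrictTo-∉ (_~? u) σ x≁u)
          (sym (restrictTo-∉ (touches? (u ∷ us)) σ λ
            { (here x~u)   → x≁u x~u
            ; (there x∈us) → x∉us x∈us })))

  class-product : ∀ us → (∀ x → x ∈ us) → C σ
  class-product us complete =
    C-resp (λ x → restrictTo-∈ (touches? us) σ (Any.map (λ { refl → ~-refl }) (complete x)))
           (product-of-parts us)

-- If the supports of `g` and `h` meet only in `s`, the commutator of `g` and `h` is the 3-cycle
-- that sends `s` to `to g s`, that to `to h s`, and that back to `s`.
module Commutator {x} {X : Set x} (_≟_ : DecidableEquality X) (g h : X ↔ X) (s : X)
  (disjoint : ∀ x → x ≢ s → to g x ≡ x ⊎ to h x ≡ x)
  (gs≢s : to g s ≢ s) (hs≢s : to h s ≢ s)
  where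

  open Transpositions _≟_

  private
    injective : ∀ (f : X ↔ X) {x y} → to f x ≡ to f y → x ≡ y
    injective f {x} {y} eq =
      trans (sym (strictlyInverseʳ f x)) (trans (cong (from f) eq) (strictlyInverseʳ f y))

    from≡ : ∀ (f : X ↔ X) {x y} → to f x ≡ y → from f y ≡ x
    from≡ f {x} refl = strictlyInverseʳ f x

    gs hs : X
    gs = to g s
    hs = to h s

    -- Since `h` moves `s`, it also moves `hs`; as `hs` is not `s`, it lies outside the support of
    -- `g`.
    g-hs : to g hs ≡ hs
    g-hs with disjoint hs hs≢s
    ... | inj₁ eq = eq
    ... | inj₂ eq = contradiction (injective h eq) hs≢s

    h-gs : to h gs ≡ gs
    h-gs with disjoint gs gs≢s
    ... | inj₁ eq = contradiction (injective g eq) gs≢s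
    ... | inj₂ eq = eq

    gs≢hs : gs ≢ hs
    gs≢hs gs≡hs = gs≢s (injective h (trans h-gs gs≡hs))

    chain : ∀ {x a b c d} → from h x ≡ a → from g a ≡ b → to h b ≡ c → to g c ≡ d →
      to g (to h (from g (from h x))) ≡ d
    chain refl refl refl refl = refl

    conclude : ∀ {l x y z} → l ≡ z → τ s gs x ≡ y → τ s hs y ≡ z → l ≡ τ s hs (τ s gs x)
    conclude refl refl refl = refl

    cases : ∀ x → Dec (x ≡ s) → Dec (x ≡ gs) → Dec (x ≡ hs) →
      to g (to h (from g (from h x))) ≡ τ s hs (τ s gs x)
    cases x (yes refl) _ _ =
      conclude (chain refl (from≡ g gb≡b) (strictlyInverseˡ h s) refl)
               (τ-first s gs) (τ-other gs≢s gs≢hs)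
      where
      b = from h s
      b≢s : b ≢ s
      b≢s b≡s = hs≢s (trans (cong (to h) (sym b≡s)) (strictlyInverseˡ h s))
      gb≡b : to g b ≡ b
      gb≡b with disjoint b b≢s
      ... | inj₁ eq = eq
      ... | inj₂ eq = contradiction (trans (sym eq) (strictlyInverseˡ h s)) b≢s
    cases x (no _) (yes refl) _ =
      conclude (chain (from≡ h h-gs) (from≡ g refl) refl g-hs) (τ-second s gs) (τ-first s hs)
    cases x (no x≢s) (no x≢gs) (yes refl) =
      conclude (chain (from≡ h refl) refl hb≡b (strictlyInverseˡ g s))
               (τ-other x≢s x≢gs) (τ-second s hs)
      where
      b = from g s
      b≢s : b ≢ s
      b≢s b≡s = gs≢s (trans (cong (to g) (sym b≡s)) (strictlyInverseˡ g s))
      hb≡b : to h b ≡ b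
      hb≡b with disjoint b b≢s
      ... | inj₁ eq = contradiction (trans (sym eq) (strictlyInverseˡ g s)) b≢s
      ... | inj₂ eq = eq
    cases x (no x≢s) (no x≢gs) (no x≢hs) =
      conclude fixed (τ-other x≢s x≢gs) (τ-other x≢s x≢hs)
      where
      -- One of `g`, `h` fixes `x`. The preimage of `x` under the other is not `s`, so it too is
      -- fixed by one of them; either way the four factors cancel.
      fixed : to g (to h (from g (from h x))) ≡ x
      fixed with disjoint x x≢s
      fixed | inj₂ hx≡x with disjoint (from g x) (x≢gs ∘ λ y≡s → trans (sym (strictlyInverseˡ g x)) (cong (to g) y≡s))
      ... | inj₁ gy≡y =
        let y≡x = trans (sym gy≡y) (strictlyInverseˡ g x) in
        chain (from≡ h hx≡x) y≡x hx≡x (trans (cong (to g) (sym y≡x)) (strictlyInverseˡ g x))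
      ... | inj₂ hy≡y = chain (from≡ h hx≡x) refl hy≡y (strictlyInverseˡ g x)
      fixed | inj₁ gx≡x with disjoint (from h x) (x≢hs ∘ λ y≡s → trans (sym (strictlyInverseˡ h x)) (cong (to h) y≡s))
      ... | inj₁ gy≡y = chain refl (from≡ g gy≡y) (strictlyInverseˡ h x) gx≡x
      ... | inj₂ hy≡y =
        let y≡x = trans (sym hy≡y) (strictlyInverseˡ h x) in
        chain y≡x (from≡ g gx≡x) (trans (cong (to h) (sym y≡x)) (strictlyInverseˡ h x)) gx≡x

  commutator : ∀ x → to g (to h (from g (from h x))) ≡ τ s hs (τ s gs x)
  commutator x = cases x (x ≟ s) (x ≟ gs) (x ≟ hs)

-- Words: swaps of two letters, and extensions of gates

lookup-ext : ∀ {a n} {A : Set a} {x y : Vec A n} → (∀ i → lookup x i ≡ lookup y i) → x ≡ y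
lookup-ext {x = x} {y} eq =
  trans (sym (Vec.tabulate∘lookup x)) (trans (Vec.tabulate-cong eq) (Vec.tabulate∘lookup y))

-- Pigeonhole: if every position occurred in `is`, its index there would define an injection from
-- `Fin n` into a smaller set.
fresh : ∀ {n} (is : List (Fin n)) → length is < n → ∃[ i ] i ∉ is
fresh {n} is len<n = Fin.¬∀⟶∃¬ n (_∈ is) (λ i → (Fin._≟_ ∈? i) is) λ all∈ →
  ℕ.<⇒≱ len<n (Fin.injective⇒≤ {f = λ i → Any.index (all∈ i)}
    λ {i} {j} → ∈ₛ.index-injective (setoid (Fin n)) (all∈ i) (all∈ j))

transpose≡transposition : ∀ {n} (i j k : Fin n) → PC.transpose i j k ≡ transposition Fin._≟_ i j k
transpose≡transposition i j k with k Fin.≟ i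
... | yes _ = refl
... | no _ with k Fin.≟ j
...   | yes _ = refl
...   | no _  = refl

module _ {a} {A : Set a} where

  -- Given position by position rather than as `t ≡ swap i j s`, so that comparing two words at one
  -- position is a projection. The field `differ` excludes the trivial swap, in particular `i ≡ j`.
  record Swap {n} (i j : Fin n) (s t : Vec A n) : Set a where
    field
      at-i    : lookup t i ≡ lookup s j
      at-j    : lookup t j ≡ lookup s i
      at-rest : ∀ {k} → k ≢ i → k ≢ j → lookup t k ≡ lookup s k
      differ  : lookup s i ≢ lookup s j

  open Swap public

  -- `wire` reads positions through the inverse permutation, hence the reversed arguments of
  -- `Perm.transpose`.
  swap : ∀ {n} → Fin n → Fin n → Vec A n → Vec A n
  swap i j = to (wire (Perm.transpose j i))

  lookup-wire : ∀ {n} (α : Permutation′ n) (x : Vec A n) i → lookup (to (wire α) x) i ≡ lookup x (α ⟨$⟩ˡ i)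
  lookup-wire α x = Vec.lookup∘tabulate _

  private
    lookup-swapped : ∀ {n} (i j : Fin n) s k → lookup (swap i j s) k ≡ lookup s (transposition Fin._≟_ i j k)
    lookup-swapped i j s k = trans (lookup-wire (Perm.transpose j i) s k) (cong (lookup s) (transpose≡transposition i j k))

    module T {n} = Transpositions (Fin._≟_ {n})

  swap-Swap : ∀ {n} (i j : Fin n) s → lookup s i ≢ lookup s j → Swap i j s (swap i j s)
  swap-Swap i j s si≢sj = record
    { at-i    = trans (lookup-swapped i j s i) (cong (lookup s) (T.τ-first i j))
    ; at-j    = trans (lookup-swapped i j s j) (cong (lookup s) (T.τ-second i j))
    ; at-rest = λ {k} k≢i k≢j → trans (lookup-swapped i j s k) (cong (lookup s) (T.τ-other k≢i k≢j))
    ; differ  = si≢sj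
    }

  Swap⇒swap : ∀ {n} {i j : Fin n} {s t} → Swap i j s t → t ≡ swap i j s
  Swap⇒swap {i = i} {j} {s} {t} sw = lookup-ext λ k → trans (pointwise k) (sym (lookup-swapped i j s k))
    where
    pointwise : ∀ k → lookup t k ≡ lookup s (transposition Fin._≟_ i j k)
    pointwise k with T.view i j k
    ... | T.first refl    = trans (at-i sw) (cong (lookup s) (sym (T.τ-first i j)))
    ... | T.second refl   = trans (at-j sw) (cong (lookup s) (sym (T.τ-second i j)))
    ... | T.other k≢i k≢j = trans (at-rest sw k≢i k≢j) (cong (lookup s) (sym (T.τ-other k≢i k≢j)))

  Swap-sym : ∀ {n} {i j : Fin n} {s t} → Swap i j s t → Swap i j t s
  Swap-sym sw = record
    { at-i    = sym (at-j sw)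
    ; at-j    = sym (at-i sw)
    ; at-rest = λ k≢i k≢j → sym (at-rest sw k≢i k≢j)
    ; differ  = λ ti≡tj → differ sw (trans (sym (at-j sw)) (trans (sym ti≡tj) (at-i sw)))
    }

  Swap⇒≢ : ∀ {n} {i j : Fin n} {s t} → Swap i j s t → s ≢ t
  Swap⇒≢ sw refl = differ sw (at-i sw)

  Swap-∷ : ∀ {n} {i j : Fin n} {s t} b → Swap i j s t → Swap (suc i) (suc j) (b ∷ s) (b ∷ t)
  Swap-∷ b sw = record
    { at-i    = at-i sw
    ; at-j    = at-j sw
    ; at-rest = λ { {zero} _ _ → refl ; {suc k} k≢i k≢j → at-rest sw (k≢i ∘ cong suc) (k≢j ∘ cong suc) }
    ; differ  = differ sw
    }

  Edge : ∀ {n} → Vec A n → Vec A n → Set a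
  Edge s t = ∃[ i ] ∃[ j ] Swap i j s t

  AgreeOff : ∀ {n} → Fin n → Vec A n → Vec A n → Set a
  AgreeOff p x y = ∀ i → i ≢ p → lookup x i ≡ lookup y i

  agree : ∀ {n} {p : Fin n} {x y} → AgreeOff p x y → lookup x p ≡ lookup y p → x ≡ y
  agree {p = p} {x} {y} off on = lookup-ext λ i → by-cases i (i Fin.≟ p)
    where
    by-cases : ∀ i → Dec (i ≡ p) → lookup x i ≡ lookup y i
    by-cases i (yes refl) = on
    by-cases i (no i≢p)   = off i i≢p

  -- Separates the wires a gate acts on from the added ones: `to (extension α f) x` unfolds to
  -- `join α (to f (front α x)) (back α x)`, which later proofs use silently.
  interleave : ∀ {m k} → Permutation′ (m + k) → (Vec A m × Vec A k) ↔ Vec A (m + k)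
  interleave {m} α = wire α ↔-∘ ++-↔ m

  extension : ∀ {m k} → Permutation′ (m + k) → B A m → B A (m + k)
  extension {k = k} α f = rewire α (f ⊕ ↔-id (Vec A k))

  front : ∀ {m k} → Permutation′ (m + k) → Vec A (m + k) → Vec A m
  front α x = proj₁ (from (interleave α) x)

  back : ∀ {m k} → Permutation′ (m + k) → Vec A (m + k) → Vec A k
  back {m} α x = proj₂ (from (interleave {m} α) x)

  join : ∀ {m k} → Permutation′ (m + k) → Vec A m → Vec A k → Vec A (m + k)
  join α y z = to (interleave α) (y , z)

  join-front-back : ∀ {m k} (α : Permutation′ (m + k)) x → join α (front {m} α x) (back {m} α x) ≡ x
  join-front-back {m} α = strictlyInverseˡ (interleave {m} α)

  front-join : ∀ {m k} (α : Permutation′ (m + k)) y z → front {m} α (join α y z) ≡ y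
  front-join {m} α y z = cong proj₁ (strictlyInverseʳ (interleave {m} α) (y , z))

  back-join : ∀ {m k} (α : Permutation′ (m + k)) y z → back {m} α (join α y z) ≡ z
  back-join {m} α y z = cong proj₂ (strictlyInverseʳ (interleave {m} α) (y , z))

  module _ {m} (p : Fin (m + 1)) where

    -- An extension by one wire leaves the last position alone; exchanging it with `p` makes `p` the
    -- untouched position.
    toLast : Permutation′ (m + 1)
    toLast = Perm.transpose (m ↑ʳ zero) p

    private
      α-last : toLast ⟨$⟩ʳ (m ↑ʳ zero) ≡ p
      α-last = trans (transpose≡transposition (m ↑ʳ zero) p (m ↑ʳ zero)) (T.τ-first (m ↑ʳ zero) p)

      α-other : ∀ {i} → i ≢ p → toLast ⟨$⟩ˡ i ≢ m ↑ʳ zero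
      α-other i≢p eq = i≢p (trans (sym (inverseʳ toLast)) (trans (cong (toLast ⟨$⟩ʳ_) eq) α-last))

    backs-agree : ∀ x y → lookup x p ≡ lookup y p → back {m} toLast x ≡ back {m} toLast y
    backs-agree x y eq = lookup-ext λ { zero → trans (at-last x) (trans eq (sym (at-last y))) }
      where
      at-last : ∀ x → lookup (back {m} toLast x) zero ≡ lookup x p
      at-last x =
        trans (sym (Vec.lookup-++ʳ (front {m} toLast x) (back {m} toLast x) zero))
        (trans (cong (λ v → lookup v (m ↑ʳ zero)) (strictlyInverseˡ (++-↔ m) (from (wire toLast) x)))
        (trans (Vec.lookup∘tabulate _ (m ↑ʳ zero)) (cong (lookup x) α-last)))

    fronts-agree : ∀ x y → front {m} toLast x ≡ front {m} toLast y → AgreeOff p x y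
    fronts-agree x y eq i i≢p =
      trans (cong (λ v → lookup v i) (sym (join-front-back {m} toLast x)))
      (trans (lookup-wire toLast (front {m} toLast x ++ back {m} toLast x) i)
      (trans (++-agree (back {m} toLast x) (back {m} toLast y) eq (toLast ⟨$⟩ˡ i) (α-other i≢p))
      (trans (sym (lookup-wire toLast (front {m} toLast y ++ back {m} toLast y) i))
             (cong (λ v → lookup v i) (join-front-back {m} toLast y)))))
      where
      ++-agree : ∀ {n} {u v : Vec A n} (b c : Vec A 1) → u ≡ v → ∀ i → i ≢ n ↑ʳ zero →
        lookup (u ++ b) i ≡ lookup (v ++ c) i
      ++-agree {u = []}    b c refl zero    i≢ = contradiction refl i≢
      ++-agree {u = _ ∷ u} b c refl zero    i≢ = refl
      ++-agree {u = _ ∷ u} b c refl (suc i) i≢ = ++-agree {u = u} b c refl i (i≢ ∘ cong suc)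

-- Weight classes, and closure of ECons under generation

module Conservation {a k} {A : Set a} (finite : A ↔ Fin k) where

  infix 4 _≟ᵃ_ _≟ʷ_ _∼_ _∼?_

  _≟ᵃ_ : DecidableEquality A
  _≟ᵃ_ = Defs._≟_ finite

  _≟ʷ_ : ∀ {n} → DecidableEquality (Vec A n)
  _≟ʷ_ = Vec.≡-dec _≟ᵃ_

  weight-++ : ∀ {m n} (x : Vec A m) (y : Vec A n) b →
    weight finite (x ++ y) b ≡ weight finite x b + weight finite y b
  weight-++ []      y b = refl
  weight-++ (c ∷ x) y b with does (c ≟ᵃ b)
  ... | true  = cong suc (weight-++ x y b)
  ... | false = weight-++ x y b

  private
    occurrence : A → A → ℕ
    occurrence b c = if does (c ≟ᵃ b) then 1 else 0

    -- As a sum over positions, the weight is seen to be invariant under `wire` by reindexing.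
    weight-sum : ∀ {n} (x : Vec A n) b → weight finite x b ≡ sum (occurrence b ∘ lookup x)
    weight-sum []      b = refl
    weight-sum (c ∷ x) b with does (c ≟ᵃ b)
    ... | true  = cong suc (weight-sum x b)
    ... | false = weight-sum x b

  weight-wire : ∀ {n} (α : Permutation′ n) x → weight finite (to (wire α) x) ≗ weight finite x
  weight-wire α x b =
    trans (weight-sum (to (wire α) x) b)
    (trans (sum-cong-≗ λ i → cong (occurrence b) (lookup-wire α x i))
    (trans (sym (sum-permute (occurrence b ∘ lookup x) (Perm.flip α)))
           (sym (weight-sum x b))))

  weight-join : ∀ {m k} (α : Permutation′ (m + k)) y z b →
    weight finite (join {m = m} α y z) b ≡ weight finite y b + weight finite z b
  weight-join α y z b = trans (weight-wire α (y ++ z) b) (weight-++ y z b)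

  weight-front-back : ∀ {m k} (α : Permutation′ (m + k)) x b →
    weight finite x b ≡ weight finite (front {m = m} α x) b + weight finite (back {m = m} α x) b
  weight-front-back {m} α x b =
    trans (cong (λ v → weight finite v b) (sym (join-front-back {m = m} α x)))
          (weight-join α (front {m = m} α x) (back {m = m} α x) b)

  -- A record, so that the words can be inferred from a proof.
  record _∼_ {n} (x y : Vec A n) : Set a where
    constructor mk∼
    field weights : weight finite x ≗ weight finite y

  open _∼_ public

  ∼-refl : ∀ {n} {x : Vec A n} → x ∼ x
  ∼-refl = mk∼ λ _ → refl

  ∼-sym : ∀ {n} {x y : Vec A n} → x ∼ y → y ∼ x
  ∼-sym (mk∼ x∼y) = mk∼ λ b → sym (x∼y b)

  ∼-trans : ∀ {n} {x y z : Vec A n} → x ∼ y → y ∼ z → x ∼ z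
  ∼-trans (mk∼ x∼y) (mk∼ y∼z) = mk∼ λ b → trans (x∼y b) (y∼z b)

  _∼?_ : ∀ {n} (x y : Vec A n) → Dec (x ∼ y)
  x ∼? y = map′
    (λ eq → mk∼ λ b → subst (λ c → weight finite x c ≡ weight finite y c) (strictlyInverseʳ finite b) (eq (to finite b)))
    (λ (mk∼ eq) i → eq (from finite i))
    (Fin.all? λ i → weight finite x (from finite i) ℕ.≟ weight finite y (from finite i))

  front-∼ : ∀ {m k} (α : Permutation′ (m + k)) {x y} → x ∼ y → back {m = m} α x ≡ back {m = m} α y →
    front {m = m} α x ∼ front {m = m} α y
  front-∼ {m} α {x} {y} (mk∼ x∼y) back≡ = mk∼ λ b → ℕ.+-cancelʳ-≡ (weight finite (back {m = m} α y) b) _ _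
    (trans (cong (λ z → weight finite (front {m = m} α x) b + weight finite z b) (sym back≡))
    (trans (sym (weight-front-back {m = m} α x b))
    (trans (x∼y b) (weight-front-back {m = m} α y b))))

  Swap⇒∼ : ∀ {n} {i j : Fin n} {s t} → Swap i j s t → s ∼ t
  Swap⇒∼ {i = i} {j} {s} sw = mk∼ λ b →
    trans (sym (weight-wire (Perm.transpose j i) s b)) (cong (λ v → weight finite v b) (sym (Swap⇒swap sw)))

  words : ∀ n → List (Vec A n)
  words 0       = [] ∷ []
  words (suc n) = cartesianProductWith _∷_ (map (from finite) (allFin k)) (words n)

  words-complete : ∀ {n} (x : Vec A n) → x ∈ words n
  words-complete []      = here refl
  words-complete (b ∷ x) = ∈.∈-cartesianProductWith⁺ _∷_
    (subst (_∈ map (from finite) (allFin k)) (strictlyInverseʳ finite b) (∈.∈-map⁺ (from finite) (∈.∈-allFin (to finite b))))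
    (words-complete x)

  module _ {n} (u : Vec A n) where

    -- The membership proof in a class is irrelevant; decidability of `_∼_` allows it to be
    -- recomputed.
    class-∼ : (X : WeightClass finite u) → value X ∼ u
    class-∼ (x , [ x∼u ]) = recompute (x ∼? u) (mk∼ x∼u)

    classWords : List (Vec A n) → List (WeightClass finite u)
    classWords []       = []
    classWords (x ∷ xs) with x ∼? u
    ... | yes x∼u = (x , [ weights x∼u ]) ∷ classWords xs
    ... | no _    = classWords xs

    classWords-complete : ∀ {xs} X → value X ∈ xs → X ∈ classWords xs
    classWords-complete {x ∷ xs} X X∈xs with x ∼? u | X∈xs
    ... | yes _  | here eq    = here (value-injective eq)
    ... | yes _  | there X∈xs = there (classWords-complete X X∈xs)
    ... | no x≁u | here refl  = contradiction (class-∼ X) x≁u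
    ... | no _   | there X∈xs = classWords-complete X X∈xs

  module C {n} (u : Vec A n) = Transpositions (class-≟ finite u)
  module W {n} = Transpositions (_≟ʷ_ {n})

  ECons-∘ : ∀ {m} {f g : B A (suc m)} → ECons finite (m , f) → ECons finite (m , g) → ECons finite (m , f ↔-∘ g)
  ECons-∘ {g = g} (f-cons , f-even) (g-cons , g-even) =
      (λ x b → trans (f-cons (to g x) b) (g-cons x b))
    , λ u → C.even-resp u (λ _ → refl) (C.even-∘ u (f-even u) (g-even u))

  ECons-resp : ∀ {m} {f g : B A (suc m)} → f ≈ g → ECons finite (m , f) → ECons finite (m , g)
  ECons-resp f≈g (f-cons , f-even) =
      (λ x b → trans (cong (λ y → weight finite y b) (sym (f≈g x))) (f-cons x b))
    , λ u → C.even-resp u (λ (x , _) → value-injective (f≈g x)) (f-even u)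

  module _ {m} {f : B A (suc m)} (f-econs : ECons finite (m , f)) {k} (α : Permutation′ (suc m + k)) where

    private
      f-cons : Conservative finite f
      f-cons = proj₁ f-econs

      F : B A (suc m + k)
      F = extension α f

      fr : Vec A (suc m + k) → Vec A (suc m)
      fr = front {m = suc m} α

      bk : Vec A (suc m + k) → Vec A k
      bk = back {m = suc m} α

    extension-conservative : Conservative finite F
    extension-conservative x b =
      trans (weight-join α (to f (fr x)) (bk x) b)
      (trans (cong (_+ weight finite (bk x) b) (f-cons (fr x) b))
             (sym (weight-front-back {m = suc m} α x b)))

    -- The weight class is split by the letters on the added wires, which the extension preserves.
    -- Through `ι`, each part is a copy of a weight class of the smaller arity, and the extension
    -- acts on it as `f` does.
    extension-even : ∀ u → C.EvenMap u (to (restrict finite F extension-conservative u))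
    extension-even u = class-product (classWords u (words _)) (λ X → classWords-complete u X (words-complete (value X)))
      where
      σ : WeightClass finite u → WeightClass finite u
      σ = to (restrict finite F extension-conservative u)

      part-even : ∀ X₀ → C.EvenMap u (restrictTo (λ X → bk (value X) ≟ʷ bk (value X₀)) σ)
      part-even X₀@(x₀ , [ p₀ ]) =
        even-image (class-≟ finite (fr x₀)) (class-≟ finite u) ι-injective
          (proj₂ f-econs (fr x₀)) σι≡ιf image
        where
        z₀ : Vec A k
        z₀ = bk x₀

        ι : WeightClass finite (fr x₀) → WeightClass finite u
        ι (y , [ p ]) = join α y z₀ , [ (λ b →
          trans (weight-join α y z₀ b)
          (trans (cong (_+ weight finite z₀ b) (p b))
          (trans (sym (weight-front-back {m = suc m} α x₀ b)) (p₀ b)))) ]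

        ι-injective : Injective _≡_ _≡_ ι
        ι-injective {y , _} {y′ , _} eq = value-injective
          (trans (sym (front-join α y z₀)) (trans (cong (fr ∘ value) eq) (front-join α y′ z₀)))

        Q? : Decidable λ X → bk (value X) ≡ z₀
        Q? X = bk (value X) ≟ʷ z₀

        σι≡ιf : ∀ Y → restrictTo Q? σ (ι Y) ≡ ι (to (restrict finite f f-cons (fr x₀)) Y)
        σι≡ιf Y@(y , _) = trans (restrictTo-∈ Q? σ (back-join α y z₀)) (value-injective
          (cong (to (interleave α) ∘ λ (y , z) → to f y , z) (strictlyInverseʳ (interleave {m = suc m} α) (y , z₀))))

        image : ∀ X → (∃[ Y ] X ≡ ι Y) ⊎ ((∀ Y → X ≢ ι Y) × restrictTo Q? σ X ≡ X)
        image X@(x , [ p ]) with Q? X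
        -- With equal letters on the added wires, the weights of the fronts agree by cancellation,
        -- so `fr x` is in the class of `fr x₀`.
        ... | yes eq = inj₁ ((fr x , [ weights (front-∼ {m = suc m} α {x} {x₀} (∼-trans (mk∼ {y = u} p) (∼-sym (mk∼ p₀))) eq) ])
                            , value-injective (trans (sym (join-front-back {m = suc m} α x)) (cong (join α (fr x)) eq)))
        ... | no neq = inj₂ ((λ (y , _) X≡ιY → neq (trans (cong (bk ∘ value) X≡ιY) (back-join α y z₀))) , refl)

      open ClassProduct {X = WeightClass finite u} {_~_ = λ X Y → bk (value X) ≡ bk (value Y)}
        refl sym trans (λ X Y → bk (value X) ≟ʷ bk (value Y))
        (C.EvenMap u) (C.even-resp u) (C.even-id u) (C.even-∘ u)
        σ (λ (x , _) → back-join α (to f (fr x)) (bk x)) part-even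

  ⌈⌉⊆ECons : ∀ {ℓ} {P : Pred (Gate A) ℓ} → P ⊆ ECons finite → ⌈ P ⌉ ⊆ ECons finite
  ⌈⌉⊆ECons P⊆ identity = (λ _ _ → refl) , λ u → C.even-resp u (λ _ → refl) (C.even-id u)
  ⌈⌉⊆ECons P⊆ (generator Pg) = P⊆ Pg
  ⌈⌉⊆ECons P⊆ (compose {f = f} {g} p q) = ECons-∘ {f = f} {g} (⌈⌉⊆ECons P⊆ p) (⌈⌉⊆ECons P⊆ q)
  ⌈⌉⊆ECons P⊆ (extend {f = f} k α p) =
    extension-conservative {f = f} (⌈⌉⊆ECons P⊆ p) α , extension-even {f = f} (⌈⌉⊆ECons P⊆ p) α
  ⌈⌉⊆ECons P⊆ (respect {f = f} {g} f≈g p) = ECons-resp {f = f} {g} f≈g (⌈⌉⊆ECons P⊆ p)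

  -- The words may overlap: with one word in common this is a 3-cycle, with two the identity.
  pair : ∀ {n} (x y z w : Vec A n) → B A n
  pair x y z w = W.τ-↔ x y ↔-∘ W.τ-↔ z w

  module _ {m} {x y z w : Vec A (suc m)} (x≢y : x ≢ y) (z≢w : z ≢ w) (x∼y : x ∼ y) (x∼z : x ∼ z) (z∼w : z ∼ w) where

    private
      τ-conservative : ∀ {n} (x y : Vec A n) → x ∼ y → Conservative finite (W.τ-↔ x y)
      τ-conservative x y (mk∼ x∼y) v b with W.view x y v
      ... | W.first refl  = trans (cong (λ t → weight finite t b) (W.τ-first x y)) (sym (x∼y b))
      ... | W.second refl = trans (cong (λ t → weight finite t b) (W.τ-second x y)) (x∼y b)
      ... | W.other v≢x v≢y = cong (λ t → weight finite t b) (W.τ-other v≢x v≢y)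

    pair-ECons : ECons finite (m , pair x y z w)
    pair-ECons = cons , even
      where
      cons : Conservative finite (pair x y z w)
      cons v b = trans (τ-conservative x y x∼y (W.τ z w v) b) (τ-conservative z w z∼w v b)

      even : ∀ u → C.EvenMap u (to (restrict finite (pair x y z w) cons u))
      even u with x ∼? u
      ... | yes x∼u =
            ts
          , ((λ eq → x≢y (cong value eq)) ∷ (λ eq → z≢w (cong value eq)) ∷ [])
          , ∣-refl
          , λ V → value-injective (sym (τ*-natural (class-≟ finite u) _≟ʷ_ value-injective ts V))
        where
        y∼u = ∼-trans (∼-sym x∼y) x∼u
        z∼u = ∼-trans (∼-sym x∼z) x∼u
        w∼u = ∼-trans (∼-sym z∼w) z∼u
        ts = ((x , [ weights x∼u ]) , (y , [ weights y∼u ])) ∷ ((z , [ weights z∼u ]) , (w , [ weights w∼u ])) ∷ []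
      ... | no x≁u = C.even-resp u
        (λ V → value-injective (sym (trans
          (cong (W.τ x y) (W.τ-other (λ V≡z → x≁u (∼-trans x∼z (in-class V V≡z)))
                                     (λ V≡w → x≁u (∼-trans x∼z (∼-trans z∼w (in-class V V≡w))))))
          (W.τ-other (λ V≡x → x≁u (in-class V V≡x))
                     (λ V≡y → x≁u (∼-trans x∼y (in-class V V≡y)))))))
        (C.even-id u)
        where
        in-class : ∀ V {v} → value V ≡ v → v ∼ u
        in-class V refl = class-∼ u V

-- Commutators of extended 3-cycles

module Generation {a ℓ k} {A : Set a} (finite : A ↔ Fin k) (P : Pred (Gate A) ℓ) where

  open Conservation finite

  -- The identity on more wires is an extension of the identity on one wire.
  ↔-id∈ : ∀ m → ⌈ P ⌉ (m , ↔-id (Vec A (suc m)))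
  ↔-id∈ m = respect (strictlyInverseˡ (interleave {m = 1} Perm.id)) (extend m Perm.id identity)

  module _ {m : ℕ} where

    -- A property of maps rather than of gates, as `ClassProduct` requires: a restricted map comes
    -- without an inverse.
    Generated : (Vec A (suc m) → Vec A (suc m)) → Set (a ⊔ ℓ)
    Generated φ = ∃[ f ] to f ≗ φ × ⌈ P ⌉ (m , f)

    generated-resp : ∀ {φ ψ} → φ ≗ ψ → Generated φ → Generated ψ
    generated-resp φ≗ψ (f , f≗φ , f∈) = f , (λ x → trans (f≗φ x) (φ≗ψ x)) , f∈

    generated-id : Generated id
    generated-id = ↔-id _ , (λ _ → refl) , ↔-id∈ m

    generated-∘ : ∀ {φ ψ} → Generated φ → Generated ψ → Generated (φ ∘ ψ)
    generated-∘ {φ} (f , f≗φ , f∈) (g , g≗ψ , g∈) =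
      f ↔-∘ g , (λ x → trans (f≗φ (to g x)) (cong φ (g≗ψ x))) , compose f∈ g∈

    Pairs : Set (a ⊔ ℓ)
    Pairs = ∀ {x y z w} → x ≢ y → z ≢ w → x ∼ y → x ∼ z → z ∼ w → ⌈ P ⌉ (m , pair x y z w)

    module _ (pairs : Pairs) (f : B A (suc m)) (f-econs : ECons finite (m , f)) where

      private
        -- A list of even length is cut into consecutive pairs, whose four words all lie in the
        -- class of `u`.
        even⇒generated : ∀ u (ts : List (WeightClass finite u × WeightClass finite u)) →
          All (uncurry _≢_) ts → 2 ∣ length ts → Generated (W.τ* (map² (class-≟ finite u) _≟ʷ_ value ts))
        even⇒generated u []      _       _   = generated-resp (λ _ → refl) generated-id
        even⇒generated u (_ ∷ []) _      2∣1 = contradiction 2∣1 (from-no (2 ∣? 1))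
        even⇒generated u ((X , Y) ∷ (Z , W) ∷ ts) (X≢Y ∷ Z≢W ∷ ≢ts) 2∣ = generated-resp (λ _ → refl)
          (generated-∘
            (pair (value X) (value Y) (value Z) (value W) , (λ _ → refl) ,
              pairs (X≢Y ∘ value-injective) (Z≢W ∘ value-injective)
                (∼-trans (class-∼ u X) (∼-sym (class-∼ u Y)))
                (∼-trans (class-∼ u X) (∼-sym (class-∼ u Z)))
                (∼-trans (class-∼ u Z) (∼-sym (class-∼ u W))))
            (even⇒generated u ts ≢ts (∣m+n∣m⇒∣n 2∣ ∣-refl)))

        part-generated : ∀ u → Generated (restrictTo (_∼? u) (to f))
        part-generated u with proj₂ f-econs u
        ... | ts , ≢ts , 2∣ts , f≗ts = generated-resp same (even⇒generated u ts ≢ts 2∣ts)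
          where
          same : W.τ* (map² (class-≟ finite u) _≟ʷ_ value ts) ≗ restrictTo (_∼? u) (to f)
          same x with x ∼? u
          ... | yes x∼u = sym (trans (cong value (f≗ts (x , [ weights x∼u ])))
            (τ*-natural (class-≟ finite u) _≟ʷ_ value-injective ts _))
          ... | no x≁u  = τ*-outside (class-≟ finite u) _≟ʷ_ value-injective ts
            λ { X refl → x≁u (class-∼ u X) }

        open ClassProduct {_~_ = _∼_} ∼-refl ∼-sym ∼-trans _∼?_ Generated generated-resp generated-id generated-∘
          (to f) (λ x → mk∼ (proj₁ f-econs x)) part-generated

      pairs⇒∈ : ⌈ P ⌉ (m , f)
      pairs⇒∈ with class-product (words (suc m)) words-complete
      ... | g , g≗f , g∈ = respect g≗f g∈

  -- The gate ignores position `p`, so it performs a 3-cycle for every letter there; this is why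
  -- `support` is stated only up to the letter at `p`. The inverse is recorded because the
  -- generation rules do not include inversion.
  record ThreeCycle {m} (p : Fin (suc m)) (s t c : Vec A (suc m)) : Set (a ⊔ ℓ) where
    field
      gate    : B A (suc m)
      gate∈   : ⌈ P ⌉ (m , gate)
      gate⁻¹∈ : ⌈ P ⌉ (m , ↔-sym gate)
      s↦t     : to gate s ≡ t
      support : ∀ x → to gate x ≡ x ⊎ (∃[ y ] y ∈ s ∷ t ∷ c ∷ [] × AgreeOff p x y)

  module Step {m : ℕ} (full : ∀ f → ECons finite (m , f) → ⌈ P ⌉ (m , f)) where

    -- The three words agree at `p`, so they stay distinct and of equal weight when `p` is removed.
    -- The 3-cycle on the shortened words is an even gate, available by `full`; reversing its two
    -- transpositions gives the inverse.
    threeCycle : ∀ (p : Fin (suc m + 1)) {s t c} → s ≢ t → s ≢ c → t ≢ c → s ∼ t → s ∼ c →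
      lookup s p ≡ lookup t p → lookup s p ≡ lookup c p → ThreeCycle p s t c
    threeCycle p {s} {t} {c} s≢t s≢c t≢c s∼t s∼c sp≡tp sp≡cp = record
      { gate    = extension α F
      ; gate∈   = extend {m = m} 1 α (full F (pair-ECons s̄≢c̄ s̄≢t̄ s̄∼c̄ ∼-refl s̄∼t̄))
      ; gate⁻¹∈ = respect (λ _ → refl) (extend {m = m} 1 α (full (pair s̄ t̄ s̄ c̄) (pair-ECons s̄≢t̄ s̄≢c̄ s̄∼t̄ ∼-refl s̄∼c̄)))
      ; s↦t     = trans
          (cong₂ (join {m = suc m} α) (trans (cong (W.τ s̄ c̄) (W.τ-first s̄ t̄)) (W.τ-other (≢-sym s̄≢t̄) t̄≢c̄)) back-st)
          (join-front-back {m = suc m} α t)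
      ; support = support
      }
      where
      α = toLast {A = A} {m = suc m} p
      bar : Vec A (suc m + 1) → Vec A (suc m)
      bar = front {m = suc m} α
      s̄ = bar s
      t̄ = bar t
      c̄ = bar c
      F = pair s̄ c̄ s̄ t̄

      back-st : back {m = suc m} α s ≡ back {m = suc m} α t
      back-st = backs-agree {m = suc m} p s t sp≡tp

      back-sc : back {m = suc m} α s ≡ back {m = suc m} α c
      back-sc = backs-agree {m = suc m} p s c sp≡cp

      bar-≢ : ∀ {x y} → x ≢ y → lookup x p ≡ lookup y p → bar x ≢ bar y
      bar-≢ {x} {y} x≢y on eq = x≢y (agree (fronts-agree {m = suc m} p x y eq) on)

      s̄≢t̄ = bar-≢ s≢t sp≡tp
      s̄≢c̄ = bar-≢ s≢c sp≡cp
      t̄≢c̄ = bar-≢ t≢c (trans (sym sp≡tp) sp≡cp)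
      s̄∼t̄ = front-∼ {m = suc m} α s∼t back-st
      s̄∼c̄ = front-∼ {m = suc m} α s∼c back-sc

      support : ∀ x → to (extension α F) x ≡ x ⊎ (∃[ y ] y ∈ s ∷ t ∷ c ∷ [] × AgreeOff p x y)
      support x = by-cases (W.view s̄ t̄ (bar x)) (W.view s̄ c̄ (bar x))
        where
        by-cases : W.View s̄ t̄ (bar x) → W.View s̄ c̄ (bar x) →
          to (extension α F) x ≡ x ⊎ (∃[ y ] y ∈ s ∷ t ∷ c ∷ [] × AgreeOff p x y)
        by-cases (W.first eq)      _                 = inj₂ (s , here refl , fronts-agree {m = suc m} p x s eq)
        by-cases (W.second eq)     _                 = inj₂ (t , there (here refl) , fronts-agree {m = suc m} p x t eq)
        by-cases (W.other _ _)     (W.first eq)      = inj₂ (s , here refl , fronts-agree {m = suc m} p x s eq)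
        by-cases (W.other _ _)     (W.second eq)     = inj₂ (c , there (there (here refl)) , fronts-agree {m = suc m} p x c eq)
        by-cases (W.other x≢s x≢t) (W.other _ x≢c) = inj₁ (trans
          (cong (λ y → join {m = suc m} α y (back {m = suc m} α x))
            (trans (cong (W.τ s̄ c̄) (W.τ-other x≢s x≢t)) (W.τ-other x≢s x≢c)))
          (join-front-back {m = suc m} α x))

  -- With p, q, r outside the four swapped positions, the third word c of g differs
  -- from s at r and the third word d of h differs from s at p, so that the
  -- supports of g (controlled by all positions but p) and h (all but q) meet only in s.
  module Adjacent {n} (cycle : ∀ (p : Fin (suc n)) {s t c} → s ≢ t → s ≢ c → t ≢ c → s ∼ t → s ∼ c →
      lookup s p ≡ lookup t p → lookup s p ≡ lookup c p → ThreeCycle p s t c)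
    {i j k l : Fin (suc n)} {s t u} (st : Swap i j s t) (su : Swap k l s u) (t≢u : t ≢ u)
    {p q r : Fin (suc n)} (q∉ : q ∉ i ∷ j ∷ k ∷ l ∷ []) (r∉ : r ∉ q ∷ i ∷ j ∷ k ∷ l ∷ [])
    (p∉ : p ∉ r ∷ q ∷ i ∷ j ∷ k ∷ l ∷ [])
    {i′ k′ : Fin (suc n)} (i′∈ : i′ ∈ i ∷ j ∷ []) (k′∈ : k′ ∈ k ∷ l ∷ [])
    {c d : Vec A (suc n)} (sc : Swap r i′ s c) (sd : Swap p k′ s d)
    where

    private
      q∉ij : q ∉ i ∷ j ∷ []
      q∉ij (here e)         = q∉ (here e)
      q∉ij (there (here e)) = q∉ (there (here e))
      q∉kl : q ∉ k ∷ l ∷ []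
      q∉kl e = q∉ (there (there e))
      r∉ij : r ∉ i ∷ j ∷ []
      r∉ij (here e)         = r∉ (there (here e))
      r∉ij (there (here e)) = r∉ (there (there (here e)))
      r∉kl : r ∉ k ∷ l ∷ []
      r∉kl e = r∉ (there (there (there e)))
      p∉ij : p ∉ i ∷ j ∷ []
      p∉ij (here e)         = p∉ (there (there (here e)))
      p∉ij (there (here e)) = p∉ (there (there (there (here e))))
      p∉kl : p ∉ k ∷ l ∷ []
      p∉kl e = p∉ (there (there (there (there e))))

      p≢r : p ≢ r
      p≢r e = p∉ (here e)
      p≢q : p ≢ q
      p≢q e = p∉ (there (here e))
      r≢q : r ≢ q
      r≢q e = r∉ (here e)

      ∉⇒≢ : ∀ {x y : Fin (suc n)} {xs} → x ∉ xs → y ∈ xs → x ≢ y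
      ∉⇒≢ x∉ y∈ refl = x∉ y∈

      off : ∀ {x i j} {y z : Vec A (suc n)} → Swap i j y z → x ∉ i ∷ j ∷ [] → lookup y x ≡ lookup z x
      off sw x∉ = sym (at-rest sw (∉⇒≢ x∉ (here refl)) (∉⇒≢ x∉ (there (here refl))))

      ∉² : ∀ {x y z : Fin (suc n)} → x ≢ y → x ≢ z → x ∉ y ∷ z ∷ []
      ∉² x≢y x≢z (here e)         = x≢y e
      ∉² x≢y x≢z (there (here e)) = x≢z e

      cr≢sr : lookup c r ≢ lookup s r
      cr≢sr e = differ sc (trans (sym e) (at-i sc))

      dp≢sp : lookup d p ≢ lookup s p
      dp≢sp e = differ sd (trans (sym e) (at-i sd))

      r-off-d : lookup s r ≡ lookup d r
      r-off-d = off sd (∉² (≢-sym p≢r) (∉⇒≢ r∉kl k′∈))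

      t≢c : t ≢ c
      t≢c refl = cr≢sr (sym (off st r∉ij))

      u≢c : u ≢ c
      u≢c refl = cr≢sr (sym (off su r∉kl))

      u≢d : u ≢ d
      u≢d refl = dp≢sp (sym (off su p∉kl))

      p-off-c : lookup s p ≡ lookup c p
      p-off-c = off sc (∉² p≢r (∉⇒≢ p∉ij i′∈))

      q-off-c : lookup s q ≡ lookup c q
      q-off-c = off sc (∉² (≢-sym r≢q) (∉⇒≢ q∉ij i′∈))

      q-off-d : lookup s q ≡ lookup d q
      q-off-d = off sd (∉² (≢-sym p≢q) (∉⇒≢ q∉kl k′∈))

      module G = ThreeCycle (cycle p (Swap⇒≢ st) (Swap⇒≢ sc) t≢c (Swap⇒∼ st) (Swap⇒∼ sc) (off st p∉ij) p-off-c)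
      module H = ThreeCycle (cycle q (Swap⇒≢ su) (Swap⇒≢ sd) u≢d (Swap⇒∼ su) (Swap⇒∼ sd) (off su q∉kl) q-off-d)

      at-p : ∀ {y} → y ∈ s ∷ t ∷ c ∷ [] → lookup s p ≡ lookup y p
      at-p (here refl)                 = refl
      at-p (there (here refl))         = off st p∉ij
      at-p (there (there (here refl))) = p-off-c

      at-q : ∀ {y} → y ∈ s ∷ t ∷ c ∷ [] → lookup s q ≡ lookup y q
      at-q (here refl)                 = refl
      at-q (there (here refl))         = off st q∉ij
      at-q (there (there (here refl))) = q-off-c

      at-q′ : ∀ {y} → y ∈ s ∷ u ∷ d ∷ [] → lookup s q ≡ lookup y q
      at-q′ (here refl)                 = refl
      at-q′ (there (here refl))         = off su q∉kl
      at-q′ (there (there (here refl))) = q-off-d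

      u∉ : u ∉ s ∷ t ∷ c ∷ []
      u∉ (here e)                 = Swap⇒≢ su (sym e)
      u∉ (there (here e))         = t≢u (sym e)
      u∉ (there (there (here e))) = u≢c e

      -- Away from p, the word d differs from s only at k′, but t differs from s at both i and j.
      d∉ : ∀ {y} → y ∈ s ∷ t ∷ c ∷ [] → ¬ AgreeOff p d y
      d∉ (here refl) d≈s = differ sd (trans (sym (at-j sd)) (d≈s k′ (≢-sym (∉⇒≢ p∉kl k′∈))))
      d∉ (there (here refl)) d≈t with i Fin.≟ k′
      ... | no i≢k′  = differ st (trans
        (off sd (∉² (≢-sym (∉⇒≢ p∉ij (here refl))) i≢k′))
        (trans (d≈t i (≢-sym (∉⇒≢ p∉ij (here refl)))) (at-i st)))
      ... | yes refl = differ st (sym (trans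
        (off sd (∉² (≢-sym (∉⇒≢ p∉ij (there (here refl)))) λ { refl → differ st refl }))
        (trans (d≈t j (≢-sym (∉⇒≢ p∉ij (there (here refl))))) (at-j st))))
      d∉ (there (there (here refl))) d≈c = cr≢sr (sym (trans r-off-d (d≈c r (≢-sym p≢r))))

      -- If both gates move `x`, it agrees off `p` with some `y` among `s`, `t`, `c` and off `q`
      -- with some `z` among `s`, `u`, `d`. All these words have the letter of `s` at `q`, so `x` is
      -- `z`. Then `z` is not `s`; if it is `u`, then `y` is also `u`, since both have the letter of
      -- `s` at `p`; and `d∉` excludes `d`.
      disjoint : ∀ x → x ≢ s → to G.gate x ≡ x ⊎ to H.gate x ≡ x
      disjoint x x≢s = by-cases (G.support x) (H.support x)
        where
        meet : ∀ {y z} → y ∈ s ∷ t ∷ c ∷ [] → AgreeOff p x y → z ∈ s ∷ u ∷ d ∷ [] → x ≢ z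
        meet y∈ x≈y (here refl)                 x≡s  = x≢s x≡s
        meet y∈ x≈y (there (here refl))         refl =
          u∉ (subst (_∈ s ∷ t ∷ c ∷ []) (sym (agree x≈y (trans (sym (off su p∉kl)) (at-p y∈)))) y∈)
        meet y∈ x≈y (there (there (here refl))) refl = d∉ y∈ x≈y

        by-cases : to G.gate x ≡ x ⊎ (∃[ y ] y ∈ s ∷ t ∷ c ∷ [] × AgreeOff p x y) →
          to H.gate x ≡ x ⊎ (∃[ z ] z ∈ s ∷ u ∷ d ∷ [] × AgreeOff q x z) →
          to G.gate x ≡ x ⊎ to H.gate x ≡ x
        by-cases (inj₁ gx≡x) _           = inj₁ gx≡x
        by-cases (inj₂ _)    (inj₁ hx≡x) = inj₂ hx≡x
        by-cases (inj₂ (y , y∈ , x≈y)) (inj₂ (z , z∈ , x≈z)) = contradiction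
          (agree x≈z (trans (x≈y q (≢-sym p≢q)) (trans (sym (at-q y∈)) (at-q′ z∈))))
          (meet y∈ x≈y z∈)

    adjacent : ⌈ P ⌉ (n , pair s u s t)
    adjacent = respect
      -- The 3-cycle of the commutator, with `s` going to `t` under the first gate and to `u` under
      -- the second.
      (λ x → trans (commutator x) (cong₂ (λ y z → W.τ s z (W.τ s y x)) G.s↦t H.s↦t))
      (compose G.gate∈ (compose H.gate∈ (compose G.gate⁻¹∈ H.gate⁻¹∈)))
      where
      open Commutator _≟ʷ_ G.gate H.gate s disjoint
        (λ e → Swap⇒≢ st (trans (sym e) G.s↦t)) (λ e → Swap⇒≢ su (trans (sym e) H.s↦t))

-- Connectivity of weight classes

module _ {a p} {A : Set a} {P : Pred A p} (P? : Decidable P) where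

  count≢0⇒∃ : ∀ {n} (x : Vec A n) → count P? x ≢ 0 → ∃[ i ] P (lookup x i)
  count≢0⇒∃ []      ≢0 = contradiction refl ≢0
  count≢0⇒∃ (c ∷ x) ≢0 with P? c
  ... | yes pc = zero , pc
  ... | no _ with i , pi ← count≢0⇒∃ x ≢0 = suc i , pi

  count-∷≢0 : ∀ {n c} (x : Vec A n) → P c → count P? (c ∷ x) ≢ 0
  count-∷≢0 {c = c} x pc eq with P? c
  ... | no ¬pc = ¬pc pc

module Connectivity {a k} {A : Set a} (finite : A ↔ Fin k) where

  open Conservation finite

  Edge-sym : ∀ {n} {s t : Vec A n} → Edge s t → Edge t s
  Edge-sym (i , j , sw) = i , j , Swap-sym sw

  Edge⇒∼ : ∀ {n} {s t : Vec A n} → Edge s t → s ∼ t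
  Edge⇒∼ (_ , _ , sw) = Swap⇒∼ sw

  Edge⇒≢ : ∀ {n} {s t : Vec A n} → Edge s t → s ≢ t
  Edge⇒≢ (_ , _ , sw) = Swap⇒≢ sw

  private
    ∷-cancel : ∀ {n} c {x y : Vec A n} → c ∷ x ∼ c ∷ y → x ∼ y
    ∷-cancel c {x} {y} (mk∼ eq) = mk∼ λ b → ℕ.+-cancelˡ-≡ (weight finite (c ∷ []) b) _ _
      (trans (sym (weight-++ (c ∷ []) x b)) (trans (eq b) (weight-++ (c ∷ []) y b)))

    -- The letter `c` occurs in `d ∷ y` because it occurs in `c ∷ x`, and not at the head;
    -- exchanging that occurrence with the head gives `c ∷ z`.
    swap-head : ∀ {n} c d {x y : Vec A n} → c ≢ d → c ∷ x ∼ d ∷ y → ∃[ z ] Edge (c ∷ z) (d ∷ y)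
    swap-head c d {x} {y} c≢d (mk∼ eq) with count≢0⇒∃ (_≟ᵃ c) (d ∷ y) (count-∷≢0 (_≟ᵃ c) x refl ∘ trans (eq c))
    ... | zero  , d≡c  = contradiction (sym d≡c) c≢d
    ... | suc i , yi≡c = y [ i ]≔ d , zero , suc i , record
      { at-i    = sym (Vec.lookup∘update i y d)
      ; at-j    = yi≡c
      ; at-rest = λ
        { {zero}  0≢0 _   → contradiction refl 0≢0
        ; {suc l} _   l≢i → sym (Vec.lookup∘update′ (l≢i ∘ cong suc) y d) }
      ; differ  = λ c≡ → c≢d (trans c≡ (Vec.lookup∘update i y d))
      }

  -- Letters are matched from the left: where the heads differ, the target is first changed by one
  -- swap that gives it the right head.
  connected : ∀ {n} (x y : Vec A n) → x ∼ y → Star Edge x y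
  connected []      []      _   = ε
  connected (c ∷ x) (d ∷ y) x∼y with c ≟ᵃ d
  ... | yes refl = gmap (c ∷_) (λ (i , j , sw) → suc i , suc j , Swap-∷ c sw) (connected x y (∷-cancel c x∼y))
  ... | no c≢d   with swap-head c d c≢d x∼y
  ...   | z , e = gmap (c ∷_) (λ (i , j , sw) → suc i , suc j , Swap-∷ c sw)
                    (connected x z (∷-cancel c (∼-trans x∼y (∼-sym (Edge⇒∼ e)))))
                  ◅◅ e ◅ ε

  -- Conjugation by the transposition of `v` and `y`, which fixes `x` and sends `v` to `y`; it is
  -- `τ-natural` with that transposition as the injection.
  τ-conjugate : ∀ {n} {x v y : Vec A n} → x ≢ y → x ≢ v → ∀ w → W.τ v y (W.τ x v (W.τ v y w)) ≡ W.τ x y w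
  τ-conjugate {x = x} {v} {y} x≢y x≢v w =
    trans (τ-natural _≟ʷ_ _≟ʷ_ τ-injective x v (W.τ v y w))
    (trans (cong₂ (λ s t → W.τ s t (W.τ v y (W.τ v y w))) (W.τ-other x≢v x≢y) (W.τ-first v y))
           (cong (W.τ x y) (W.τ-involutive v y w)))
    where
    τ-injective : Injective _≡_ _≡_ (W.τ v y)
    τ-injective {s} {t} eq =
      trans (sym (W.τ-involutive v y s)) (trans (cong (W.τ v y) eq) (W.τ-involutive v y t))

-- From adjacent 3-cycles to all pairs, and the induction on the arity

module Completeness {a ℓ k} {A : Set a} (finite : A ↔ Fin k) (P : Pred (Gate A) ℓ) where

  open Conservation finite
  open Connectivity finite
  open Generation finite P

  module _ {m} (adjacent : ∀ {s t u : Vec A (suc m)} → Edge s t → Edge s u → t ≢ u → ⌈ P ⌉ (m , pair s u s t)) where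

    private
      Word : Set a
      Word = Vec A (suc m)

      -- The transposition of `s` and `t` is inserted twice and cancels.
      via : ∀ {x y z w : Word} s t → ⌈ P ⌉ (m , pair x y s t) → ⌈ P ⌉ (m , pair s t z w) → ⌈ P ⌉ (m , pair x y z w)
      via {x} {y} {z} {w} s t p q = respect
        (λ v → cong (W.τ x y) (W.τ-involutive s t (W.τ z w v))) (compose p q)

      cofinal : ∀ {s t u : Word} → Edge s t → Edge s u → ⌈ P ⌉ (m , pair s t s u)
      cofinal {s} {t} {u} e f = by-cases (u ≟ʷ t)
        where
        by-cases : Dec (u ≡ t) → ⌈ P ⌉ (m , pair s t s u)
        by-cases (yes refl) = respect (λ v → sym (W.τ-involutive s t v)) (↔-id∈ m)
        by-cases (no u≢t)   = adjacent f e u≢t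

      -- Induction along a walk from `x` to `z`: the transposition along its first edge is inserted
      -- twice. One copy shares `x` with the first edge transposition, the other starts nearer to
      -- `z`.
      edges : ∀ {x y z w : Word} → Star Edge x z → Edge x y → Edge z w → ⌈ P ⌉ (m , pair x y z w)
      edges ε             e f = cofinal e f
      edges {x} {z = z} {w} (_◅_ {j = v} g p) e f = via x v (cofinal e g)
        (respect (λ t → W.τ-comm v x (W.τ z w t)) (edges p (Edge-sym g) f))

      -- Induction along a walk from `z` to `w` with first step to `v`: the second transposition
      -- equals (v w)(z v)(v w), and the resulting four factors group into the pairs (x y)(v w) and
      -- (z v)(v w).
      edge-pair : ∀ {x y z w : Word} → z ≢ w → Star Edge z w → Star Edge x z → Edge x y → ⌈ P ⌉ (m , pair x y z w)
      edge-pair z≢w ε _ _ = contradiction refl z≢w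
      edge-pair {x} {y} {z} {w} z≢w (_◅_ {j = v} f p) q e = by-cases (v ≟ʷ w)
        where
        by-cases : Dec (v ≡ w) → ⌈ P ⌉ (m , pair x y z w)
        by-cases (yes refl) = edges q e f
        by-cases (no v≢w)   = respect
          (λ t → cong (W.τ x y) (τ-conjugate z≢w (Edge⇒≢ f) t))
          (compose (edge-pair v≢w p (q ◅◅ f ◅ ε) e) (edge-pair v≢w p (f ◅ ε) f))

      -- The same conjugation now replaces the first transposition: (x y)(z w) is the product of the
      -- pairs (v y)(x v) and (v y)(z w).
      path-pair : ∀ {x y z w : Word} → x ≢ y → z ≢ w → Star Edge x y → Star Edge x z → Star Edge z w →
        ⌈ P ⌉ (m , pair x y z w)
      path-pair x≢y _ ε _ _ = contradiction refl x≢y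
      path-pair {x} {y} {z} {w} x≢y z≢w (_◅_ {j = v} e p) q r = by-cases (v ≟ʷ y)
        where
        by-cases : Dec (v ≡ y) → ⌈ P ⌉ (m , pair x y z w)
        by-cases (yes refl) = edge-pair z≢w r q e
        by-cases (no v≢y)   = respect
          (λ t → τ-conjugate x≢y (Edge⇒≢ e) (W.τ z w t))
          (compose (path-pair v≢y (Edge⇒≢ e) p (Edge-sym e ◅ ε) (e ◅ ε))
                   (path-pair v≢y z≢w p (Edge-sym e ◅ q) r))

    adjacent⇒pairs : Pairs {m}
    adjacent⇒pairs x≢y z≢w x∼y x∼z z∼w =
      path-pair x≢y z≢w (connected _ _ x∼y) (connected _ _ x∼z) (connected _ _ z∼w)

  private
    -- No letter equals two different ones. This finds the partner for the swap that produces a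
    -- third word.
    differing : ∀ {n} {x : Vec A n} {i j} → lookup x i ≢ lookup x j → ∀ l →
      ∃[ h ] h ∈ i ∷ j ∷ [] × lookup x l ≢ lookup x h
    differing {x = x} {i} {j} xi≢xj l = by-cases (lookup x l ≟ᵃ lookup x i)
      where
      by-cases : Dec (lookup x l ≡ lookup x i) → ∃[ h ] h ∈ i ∷ j ∷ [] × lookup x l ≢ lookup x h
      by-cases (no xl≢xi)  = i , here refl , xl≢xi
      by-cases (yes xl≡xi) = j , there (here refl) , λ xl≡xj → xi≢xj (trans (sym xl≡xi) xl≡xj)

  Full : ℕ → Set (a ⊔ ℓ)
  Full m = ∀ f → ECons finite (m , f) → ⌈ P ⌉ (m , f)

  -- The index `m` stands for arity `suc m`, so the new arity is at least 7. The two swaps occupy at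
  -- most four positions, then `q`, `r`, `p` are chosen in turn, and `p` has up to six positions to
  -- avoid.
  full-suc : ∀ {m} → 5 ≤ m → Full m → Full (suc m)
  -- Adding one wire on the right gives the index `m + 1`, to be read as `suc m`.
  full-suc {m} 5≤m full = subst Full (ℕ.+-comm m 1) λ f → pairs⇒∈ (adjacent⇒pairs adjacent) f
    where
    adjacent : ∀ {s t u : Vec A (suc m + 1)} → Edge s t → Edge s u → t ≢ u → ⌈ P ⌉ (m + 1 , pair s u s t)
    adjacent {s} (i , j , st) (k , l , su) t≢u =
      let q , q∉           = fresh (i ∷ j ∷ k ∷ l ∷ []) (room 4 (ℕ.m≤m+n 4 2))
          r , r∉           = fresh (q ∷ i ∷ j ∷ k ∷ l ∷ []) (room 5 (ℕ.m≤m+n 5 1))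
          p , p∉           = fresh (r ∷ q ∷ i ∷ j ∷ k ∷ l ∷ []) (room 6 ℕ.≤-refl)
          i′ , i′∈ , sr≢si′ = differing {x = s} (differ st) r
          k′ , k′∈ , sp≢sk′ = differing {x = s} (differ su) p
      in Adjacent.adjacent (Step.threeCycle full) st su t≢u q∉ r∉ p∉ i′∈ k′∈
           (swap-Swap r i′ s sr≢si′) (swap-Swap p k′ s sp≢sk′)
      where
      room : ∀ a → a ≤ 6 → a < suc m + 1
      room a a≤6 = s≤s (ℕ.≤-trans a≤6 (subst (6 ≤_) (ℕ.+-comm 1 m) (s≤s 5≤m)))

  full : (∀ {m} → suc m ≤ 6 → Full m) → ∀ m → Full m
  full small 0       = small (s≤s z≤n)
  full small (suc m) = by-cases (suc (suc m) ℕ.≤? 6)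
    where
    by-cases : Dec (suc (suc m) ≤ 6) → Full (suc m)
    by-cases (yes m≤) = small m≤
    by-cases (no m≰)  = full-suc (s≤s⁻¹ (s≤s⁻¹ (ℕ.≰⇒> m≰))) (full small m)

-- The finite generating set

module _ {a k} {A : Set a} (finite : A ↔ Fin k) where

  open Conservation finite

  private
    Quad : ℕ → Set a
    Quad n = (Vec A n × Vec A n) × (Vec A n × Vec A n)

    Admissible : ∀ {n} → Quad n → Set a
    Admissible ((x , y) , (z , w)) = x ≢ y × z ≢ w × x ∼ y × x ∼ z × z ∼ w

    admissible? : ∀ {n} → Decidable (Admissible {n})
    admissible? ((x , y) , (z , w)) =
      ¬? (x ≟ʷ y) ×-dec ¬? (z ≟ʷ w) ×-dec (x ∼? y) ×-dec (x ∼? z) ×-dec (z ∼? w)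

    quads : ∀ n → List (Quad n)
    quads n = cartesianProduct (cartesianProduct (words n) (words n)) (cartesianProduct (words n) (words n))

    gate : ∀ {m} → Quad (suc m) → Gate A
    gate {m} ((x , y) , (z , w)) = m , pair x y z w

    gatesOf : ℕ → List (Gate A)
    gatesOf m = map gate (filter admissible? (quads (suc m)))

  -- The indices 0 to 5 stand for the arities 1 to 6.
  smallPairs : List (Gate A)
  smallPairs = concatMap gatesOf (upTo 6)

  smallPairs⊆ECons : (_∈ smallPairs) ⊆ ECons finite
  smallPairs⊆ECons {g} g∈ with find (∈.∈-concatMap⁻ gatesOf {xs = upTo 6} g∈)
  ... | m , _ , g∈m with ∈.∈-map⁻ gate g∈m
  ...   | quad , quad∈ , refl with ∈.∈-filter⁻ admissible? {xs = quads (suc m)} quad∈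
  ...     | _ , x≢y , z≢w , x∼y , x∼z , z∼w = pair-ECons x≢y z≢w x∼y x∼z z∼w

  pair∈smallPairs : ∀ {m} {x y z w : Vec A (suc m)} → suc m ≤ 6 → Admissible ((x , y) , (z , w)) →
    (m , pair x y z w) ∈ smallPairs
  pair∈smallPairs {m} {x} {y} {z} {w} m<6 adm = ∈.∈-concatMap⁺ gatesOf
    (lose (∈.∈-upTo⁺ m<6) (∈.∈-map⁺ gate (∈.∈-filter⁺ admissible?
      (∈.∈-cartesianProduct⁺ (∈.∈-cartesianProduct⁺ (words-complete x) (words-complete y))
                             (∈.∈-cartesianProduct⁺ (words-complete z) (words-complete w))) adm)))

theorem23 : ∀ {a ℓ k} {A : Set a} (finite : A ↔ Fin k) →
    (Σ[ gs ∈ List (Gate A) ] ⌈ _∈ gs ⌉ ≐ ECons finite)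
    × ((P : Pred (Gate A) ℓ) → P ⊆ ECons finite →
    (∀ {m} (f : B A (suc m)) → suc m ≤ 6 → ECons finite (m , f) → ⌈ P ⌉ (m , f)) →
    ⌈ P ⌉ ≐ ECons finite)
theorem23 finite =
    ( smallPairs finite
    , ⌈⌉⊆ECons (smallPairs⊆ECons finite)
    , λ {g} → Completeness.full finite (_∈ smallPairs finite) small (proj₁ g) (proj₂ g))
  , λ P P⊆ small≤6 → ⌈⌉⊆ECons P⊆ , λ {g} → Completeness.full finite P (λ m<6 f → small≤6 f m<6) (proj₁ g) (proj₂ g)
  where
  open Conservation finite

  -- In these arities every admissible pair is itself a generator, so the induction has its base.
  small : ∀ {m} → suc m ≤ 6 → Completeness.Full finite (_∈ smallPairs finite) m
  small m<6 f = Generation.pairs⇒∈ finite (_∈ smallPairs finite)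
    (λ x≢y z≢w x∼y x∼z z∼w → generator (pair∈smallPairs finite m<6 (x≢y , z≢w , x∼y , x∼z , z∼w))) f
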